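{- Every oriented graph $D$ that has no induced subdigraph isomorphic to $\vec{P}_6$ and satisfies $\omega(D)\le 2$ has dichromatic number $\vec{\chi}(D)\le 382$.
   Context: An oriented graph is a digraph with no loops, no parallel arcs and no pair of opposite arcs. $\vec{P}_6$ is the directed path on six vertices $x_1\to x_2\to\dots\to x_6$; containing it as an induced subdigraph means there are six vertices inducing exactly these arcs. $\omega(D)$ is the clique number of the underlying graph of $D$ (so $\omega(D)\le 2$ means $D$ contains no triangle in its underlying graph). The dichromatic number $\vec{\chi}(D)$ is the least number of parts in a partition of $V(D)$ into sets inducing acyclic subdigraphs. -}

module Defs where

open import Data.Nat using (ℕ; suc)
open import Data.Fin using (Fin; zero; suc; toℕ; inject₁; fromℕ)
open import Data.Product using (Σ; _×_)
open import Data.Sum using (_⊎_)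
open import Relation.Nullary using (¬_)
open import Relation.Binary.PropositionalEquality using (_≡_)
open import Function.Definitions using (Injective)
open import Function.Bundles using (_⇔_)
open import Level using (0ℓ)

record Digraph : Set₁ where
  field
    n   : ℕ
    Arc : Fin n → Fin n → Set
    arc? : ∀ u v → Relation.Nullary.Dec (Arc u v)
open Digraph public

-- Oriented: no loops and no pair of opposite arcs (parallel arcs are
-- impossible since arcs form a relation).
Oriented : Digraph → Set
Oriented D = (∀ v → ¬ Arc D v v) × (∀ u v → Arc D u v → ¬ Arc D v u)

Adj : (D : Digraph) → Fin (n D) → Fin (n D) → Set
Adj D u v = Arc D u v ⊎ Arc D v u

-- ω(D) ≤ 2 : the underlying graph has no triangle
TriangleFree : Digraph → Set
TriangleFree D = ∀ u v w → Adj D u v → Adj D v w → Adj D u w → ⊥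
  where open import Data.Empty using (⊥)

ContainsInducedP6 : Digraph → Set
ContainsInducedP6 D =
  Σ (Fin 6 → Fin (n D)) λ f →
    Injective _≡_ _≡_ f ×
    (∀ i j → (Arc D (f i) (f j) ⇔ (toℕ j ≡ suc (toℕ i))))

DirectedCycleIn : (D : Digraph) → (Fin (n D) → Set) → Set
DirectedCycleIn D S =
  Σ ℕ λ k → Σ (Fin (suc k) → Fin (n D)) λ c →
    Injective _≡_ _≡_ c ×
    (∀ i → S (c i)) ×
    (∀ (i : Fin k) → Arc D (c (inject₁ i)) (c (suc i))) ×
    Arc D (c (fromℕ k)) (c zero)

Acyclic : (D : Digraph) → (Fin (n D) → Set) → Set
Acyclic D S = ¬ DirectedCycleIn D S

DichromaticAtMost : ℕ → Digraph → Set
DichromaticAtMost k D =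
  Σ (Fin (n D) → Fin k) λ col → ∀ (a : Fin k) → Acyclic D (λ v → col v ≡ a)

{-# OPTIONS --safe #-}
module Submission where

-- Let c be a shortest odd directed closed walk of D[W], let X be the set of vertices of W adjacent to c
-- (it contains c) and call the other vertices of W far.  Two consecutive arcs of c in front of x ∈ X form an
-- induced path with x, so P₆-freeness gives: if c → x → z₀ → z₁ → z₂ with the zᵢ far, then x and z₂ are
-- adjacent; and since c is odd, an x that only receives arcs from c starts no path x → z₀ → z₁ into the far
-- vertices at all.  Dually for x → c.  Hence X, the far neighbours of the vertices of X that have arcs in both
-- directions to c, one further layer beyond these, and the far out- or in-neighbours of the other vertices of X
-- form a nice set: each of its vertices has no out-neighbour or no in-neighbour among the remaining vertices.
-- The nice set needs 13 + 13 colours, and the rest, coloured by recursion, may reuse them.  A D[W] without odd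
-- closed walk has bipartite strong components and needs two colours.  So 26 colours suffice altogether.
--
-- Most colour classes come from labels: v is labelled with its first neighbour b in an ordered set.  If b → v
-- and a path of two arcs leads to b through vertices that are not adjacent to anything labelled b or later,
-- then no path u → v → w has its smallest label only at u, and this yields two colours.  The vertices v of X
-- with first and last neighbours c g ← v ← c h on the walk are coloured by the parity of h, because c has no
-- shorter odd competitor.

open import Defs
open import Data.Empty using (⊥)
open import Data.Fin as Fin using (Fin; zero; suc; toℕ; join; splitAt)
open import Data.Fin.Properties as Fin using (splitAt-join; any?)
open import Data.List.Base using (List; []; _∷_; length; filter; allFin; cartesianProduct)
open import Data.List.Membership.Propositional using (_∈_)
open import Data.List.Membership.Propositional.Properties using (∈-allFin; ∈-cartesianProduct⁺)
open import Data.List.Relation.Unary.Any using (here; there)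
open import Data.Nat.Base
open import Data.Nat.DivMod using (_%_; _/_; m≡m%n+[m/n]*n; m%n<n)
open import Data.Nat.GeneralisedArithmetic using (fold; fold-+)
open import Data.Nat.Induction using (<-wellFounded)
open import Data.Nat.Properties
open import Data.Parity.Base as ℙ using (Parity; 0ℙ; 1ℙ)
import Data.Parity.Properties as ℙ
open import Data.Product.Base using (Σ; ∃; ∃₂; _×_; _,_; proj₁; proj₂)
open import Data.Sum.Base using (_⊎_; inj₁; inj₂; swap)
open import Data.Sum.Properties using (inj₁-injective; inj₂-injective)
open import Data.Unit.Base using (⊤; tt)
open import Data.Vec.Base using (Vec; []; _∷_; lookup)
open import Data.Vec.Relation.Unary.All using (All; []; _∷_)
open import Data.Vec.Relation.Unary.All.Properties using (lookup⁺)
open import Function.Base using (_∘_; flip; case_of_)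
open import Function.Bundles using (_⇔_; mk⇔; Equivalence)
open import Induction.WellFounded using (Acc; acc)
open import Level using (0ℓ)
open import Relation.Binary.Core using (Rel)
import Relation.Binary.Definitions as Binary
open import Relation.Binary.PropositionalEquality
open import Relation.Nullary using (¬_; Dec; yes; no; contradiction)
open import Relation.Nullary.Decidable using (map′; ¬?; _×-dec_; _⊎-dec_; decidable-stable)
open import Relation.Unary using (Pred; Decidable; _∩_; ∁; _⊆_; U)

-- Bounded search and counting.

first : {P : Pred ℕ 0ℓ} → Decidable P → ℕ → ℕ
first P? zero    = zero
first P? (suc m) with P? zero
... | yes _ = zero
... | no  _ = suc (first (P? ∘ suc) m)

-- The search stops at its bound without testing it, so the value never exceeds `m`; this settles
-- every `j` beyond `m`.
first-minimal : {P : Pred ℕ 0ℓ} (P? : Decidable P) (m : ℕ) {j : ℕ} → P j → first P? m ≤ j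
first-minimal P? zero    _ = z≤n
first-minimal P? (suc m) {j} p with P? zero
first-minimal P? (suc m) {j}     p | yes _ = z≤n
first-minimal P? (suc m) {zero}  p | no ¬p = contradiction p ¬p
first-minimal P? (suc m) {suc j} p | no _  = s≤s (first-minimal (P? ∘ suc) m p)

first-holds : {P : Pred ℕ 0ℓ} (P? : Decidable P) (m : ℕ) {j : ℕ} → P j → j ≤ m → P (first P? m)
first-holds P? zero    p z≤n = p
first-holds P? (suc m) {j} p j≤m with P? zero
first-holds P? (suc m) {j}     p _         | yes p₀ = p₀
first-holds P? (suc m) {zero}  p _         | no ¬p  = contradiction p ¬p
first-holds P? (suc m) {suc j} p (s≤s j≤m) | no _   = first-holds (P? ∘ suc) m p j≤m

last : {P : Pred ℕ 0ℓ} → Decidable P → ℕ → ℕ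
last P? zero    = zero
last P? (suc m) with P? (suc m)
... | yes _ = suc m
... | no  _ = last P? m

last-bound : {P : Pred ℕ 0ℓ} (P? : Decidable P) (m : ℕ) → last P? m ≤ m
last-bound P? zero    = z≤n
last-bound P? (suc m) with P? (suc m)
... | yes _ = ≤-refl
... | no  _ = m≤n⇒m≤1+n (last-bound P? m)

last-maximal : {P : Pred ℕ 0ℓ} (P? : Decidable P) (m : ℕ) {j : ℕ} → P j → j ≤ m → j ≤ last P? m
last-maximal P? zero    _ j≤0 = j≤0
last-maximal P? (suc m) p j≤m with P? (suc m) | m≤n⇒m<n∨m≡n j≤m
... | yes _ | _              = j≤m
... | no _  | inj₁ (s≤s j≤m) = last-maximal P? m p j≤m
... | no ¬p | inj₂ refl      = contradiction p ¬p

last-holds : {P : Pred ℕ 0ℓ} (P? : Decidable P) (m : ℕ) {j : ℕ} → P j → j ≤ m → P (last P? m)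
last-holds P? zero    p z≤n = p
last-holds P? (suc m) p j≤m with P? (suc m) | m≤n⇒m<n∨m≡n j≤m
... | yes p′ | _              = p′
... | no _   | inj₁ (s≤s j≤m) = last-holds P? m p j≤m
... | no ¬p  | inj₂ refl      = contradiction p ¬p

module _ {A : Set} {P Q : Pred A 0ℓ} (P? : Decidable P) (Q? : Decidable Q) (P⊆Q : P ⊆ Q) where

  count-mono : ∀ xs → length (filter P? xs) ≤ length (filter Q? xs)
  count-mono []       = z≤n
  count-mono (x ∷ xs) with P? x | Q? x
  ... | yes _ | yes _ = s≤s (count-mono xs)
  ... | yes p | no ¬q = contradiction (P⊆Q p) ¬q
  ... | no _  | yes _ = m≤n⇒m≤1+n (count-mono xs)
  ... | no _  | no _  = count-mono xs

  count-mono-< : ∀ {x xs} → x ∈ xs → ¬ P x → Q x → length (filter P? xs) < length (filter Q? xs)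
  count-mono-< {x} {y ∷ xs} x∈ ¬p q with P? y | Q? y | x∈
  ... | yes p | _     | here refl = contradiction p ¬p
  ... | no _  | yes _ | here refl = s≤s (count-mono xs)
  ... | no _  | no ¬q | here refl = contradiction q ¬q
  ... | yes _ | yes _ | there x∈′ = s≤s (count-mono-< x∈′ ¬p q)
  ... | yes p | no ¬q | there _   = contradiction (P⊆Q p) ¬q
  ... | no _  | yes _ | there x∈′ = m≤n⇒m≤1+n (count-mono-< x∈′ ¬p q)
  ... | no _  | no _  | there x∈′ = count-mono-< x∈′ ¬p q

-- Serves to turn ranks upside down and to stack one family of ranks above another.
bound : ∀ {n} (ρ : Fin n → ℕ) → ∃ λ M → ∀ v → ρ v < M
bound {zero}  ρ = zero , λ ()
bound {suc n} ρ = let M , below = bound (ρ ∘ suc) in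
  suc (ρ zero) ⊔ M ,
  λ { zero → m≤m⊔n (suc (ρ zero)) M ; (suc v) → <-≤-trans (below v) (m≤n⊔m (suc (ρ zero)) M) }

-- Colourings certified by ranks.

-- Acyclicity of the colour classes is certified by a rank that decreases along monochromatic arcs.
record Colouring {n : ℕ} (R : Rel (Fin n) 0ℓ) (k : ℕ) (W : Pred (Fin n) 0ℓ) : Set where
  field
    colour   : Fin n → Fin k
    rank     : Fin n → ℕ
    descends : ∀ {u v} → W u → W v → R u v → colour u ≡ colour v → rank v < rank u
open Colouring

module _ {n : ℕ} {R : Rel (Fin n) 0ℓ} where

  restrict : ∀ {k} {V W : Pred (Fin n) 0ℓ} → V ⊆ W → Colouring R k W → Colouring R k V
  restrict V⊆W γ .colour = colour γ
  restrict V⊆W γ .rank   = rank γ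
  restrict V⊆W γ .descends Vu Vv = descends γ (V⊆W Vu) (V⊆W Vv)

  widen : ∀ {j k} {W : Pred (Fin n) 0ℓ} → j ≤ k → Colouring R j W → Colouring R k W
  widen j≤k γ .colour v = Fin.inject≤ (colour γ v) j≤k
  widen j≤k γ .rank     = rank γ
  widen j≤k γ .descends Wu Wv uv eq = descends γ Wu Wv uv (Fin.inject≤-injective j≤k j≤k _ _ eq)

  -- Subtracting the ranks from a common bound restores the descent after all arcs are turned round;
  -- this gives the dual colourings.
  reverse : ∀ {k} {W : Pred (Fin n) 0ℓ} → Colouring (flip R) k W → Colouring R k W
  reverse γ .colour = colour γ
  reverse γ .rank v = proj₁ (bound (rank γ)) ∸ rank γ v
  reverse γ .descends {v = v} Wu Wv uv eq =
    ∸-monoʳ-< (descends γ Wv Wu uv (sym eq)) (<⇒≤ (proj₂ (bound (rank γ)) v))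

  ranked : ∀ {W : Pred (Fin n) 0ℓ} (ρ : Fin n → ℕ) →
    (∀ {u v} → W u → W v → R u v → ρ v < ρ u) → Colouring R 1 W
  ranked ρ desc .colour _ = zero
  ranked ρ desc .rank     = ρ
  ranked ρ desc .descends Wu Wv uv _ = desc Wu Wv uv

  independent : ∀ {W : Pred (Fin n) 0ℓ} → (∀ {u v} → W u → W v → ¬ R u v) → Colouring R 1 W
  independent none = ranked (λ _ → 0) λ Wu Wv uv → contradiction uv (none Wu Wv)

  -- An arc that increases the label has a head that is Entered and, by the second hypothesis, a tail that
  -- is not; so labels decrease along monochromatic arcs.
  labelled : ∀ {W : Pred (Fin n) 0ℓ} → Decidable W → Binary.Decidable R → (g : Fin n → ℕ) →
    (∀ {u v} → W u → W v → R u v → g u ≢ g v) →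
    (∀ {u v w} → W u → W v → W w → R u v → R v w → g u < g v → ¬ g u < g w) →
    Colouring R 2 W
  labelled {W} W? R? g distinct no-valley =
    record { colour = col ∘ entered? ; rank = g
           ; descends = λ {u} {v} Wu Wv uv eq → desc Wu Wv uv (entered? u) (entered? v) eq }
    where
    Entered : Pred (Fin n) 0ℓ
    Entered v = ∃ λ u → W u × R u v × g u < g v
    entered? : Decidable Entered
    entered? v = any? λ u → W? u ×-dec R? u v ×-dec (g u <? g v)
    col : ∀ {P : Set} → Dec P → Fin 2
    col (yes _) = zero
    col (no  _) = suc zero
    desc : ∀ {u v} → W u → W v → R u v → (du : Dec (Entered u)) (dv : Dec (Entered v)) →
      col du ≡ col dv → g v < g u
    desc {u} {v} Wu Wv uv du dv eq with <-cmp (g u) (g v)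
    ... | Binary.tri≈ _ gu≡gv _ = contradiction gu≡gv (distinct Wu Wv uv)
    ... | Binary.tri> _ _ gv<gu = gv<gu
    desc {u} {v} Wu Wv uv (yes (t , Wt , tu , gt<gu)) _ eq | Binary.tri< gu<gv _ _ =
      contradiction (<-trans gt<gu gu<gv) (no-valley Wt Wu Wv tu uv gt<gu)
    desc Wu Wv uv (no _) (no ¬e) eq | Binary.tri< gu<gv _ _ = contradiction (_ , Wu , uv , gu<gv) ¬e

  join-injective : ∀ a b {x y : Fin a ⊎ Fin b} → join a b x ≡ join a b y → x ≡ y
  join-injective a b {x} {y} eq =
    trans (sym (splitAt-join a b x)) (trans (cong (splitAt a) eq) (splitAt-join a b y))

  -- Disjoint palettes leave no monochromatic arc between the two sides, so the two ranks are
  -- independent of each other.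
  separate : ∀ {a b} {P W : Pred (Fin n) 0ℓ} → Decidable P →
    Colouring R a (W ∩ P) → Colouring R b (W ∩ ∁ P) → Colouring R (a + b) W
  separate {a} {b} {P} {W} P? γ δ =
    record { colour = λ v → join a b (col (P? v)) ; rank = λ v → rk (P? v)
           ; descends = λ {u} {v} Wu Wv uv eq →
               desc Wu Wv uv (P? u) (P? v) (join-injective a b eq) }
    where
    col : ∀ {v} → Dec (P v) → Fin a ⊎ Fin b
    col {v} (yes _) = inj₁ (colour γ v)
    col {v} (no  _) = inj₂ (colour δ v)
    rk : ∀ {v} → Dec (P v) → ℕ
    rk {v} (yes _) = rank γ v
    rk {v} (no  _) = rank δ v
    desc : ∀ {u v} → W u → W v → R u v → (du : Dec (P u)) (dv : Dec (P v)) →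
      col du ≡ col dv → rk dv < rk du
    desc Wu Wv uv (yes Pu) (yes Pv) eq = descends γ (Wu , Pu) (Wv , Pv) uv (inj₁-injective eq)
    desc Wu Wv uv (no ¬Pu) (no ¬Pv) eq = descends δ (Wu , ¬Pu) (Wv , ¬Pv) uv (inj₂-injective eq)

  -- P ∪ Q is a nice set: a closed walk that meets both it and the rest leaves P or enters Q on the way.
  nice : ∀ {a b} {P Q W : Pred (Fin n) 0ℓ} → Decidable P → Decidable Q →
    let Rest = W ∩ ∁ P ∩ ∁ Q in
    (∀ {u v} → W u → P u → Rest v → ¬ R u v) →
    (∀ {u v} → Rest u → W v → ¬ P v → Q v → ¬ R u v) →
    Colouring R a (W ∩ P) → Colouring R b (W ∩ ∁ P ∩ Q) → Colouring R (a + b) Rest →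
    Colouring R (a + b) W
  nice {a} {b} {P} {Q} {W} P? Q? out in′ γ δ ε =
    record { colour = λ v → col (P? v) (Q? v) ; rank = λ v → rk (P? v) (Q? v)
           ; descends = λ {u} {v} Wu Wv uv eq →
               desc Wu Wv uv (P? u) (Q? u) (P? v) (Q? v) eq }
    where
    -- Ranks are stacked with `P` below `M`, the rest from `M` up to `N`, and `Q` from `N` on. Arcs
    -- between the rest and the nice set only run from `Q` to the rest and from the rest to `P`,
    -- hence downwards; `P` and `Q` share no colour.
    M N : ℕ
    M = proj₁ (bound (rank γ))
    N = proj₁ (bound (λ v → M + rank ε v))
    col : ∀ {v} → Dec (P v) → Dec (Q v) → Fin (a + b)
    col {v} (yes _) _       = join a b (inj₁ (colour γ v))
    col {v} (no  _) (yes _) = join a b (inj₂ (colour δ v))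
    col {v} (no  _) (no  _) = colour ε v
    rk : ∀ {v} → Dec (P v) → Dec (Q v) → ℕ
    rk {v} (yes _) _       = rank γ v
    rk {v} (no  _) (yes _) = N + rank δ v
    rk {v} (no  _) (no  _) = M + rank ε v
    desc : ∀ {u v} → W u → W v → R u v →
      (pu : Dec (P u)) (qu : Dec (Q u)) (pv : Dec (P v)) (qv : Dec (Q v)) →
      col pu qu ≡ col pv qv → rk pv qv < rk pu qu
    desc Wu Wv uv (yes p) _ (yes p′) _ eq =
      descends γ (Wu , p) (Wv , p′) uv (inj₁-injective (join-injective a b eq))
    desc Wu Wv uv (yes p) _ (no ¬p) (yes q) eq with () ← join-injective a b {inj₁ _} {inj₂ _} eq
    desc Wu Wv uv (yes p) _ (no ¬p) (no ¬q) eq = contradiction uv (out Wu p (Wv , ¬p , ¬q))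
    desc Wu Wv uv (no ¬p) (yes q) (yes p) _ eq with () ← join-injective a b {inj₂ _} {inj₁ _} eq
    desc Wu Wv uv (no ¬p) (yes q) (no ¬p′) (yes q′) eq =
      +-monoʳ-< N (descends δ (Wu , ¬p , q) (Wv , ¬p′ , q′) uv (inj₂-injective (join-injective a b eq)))
    desc {v = v} Wu Wv uv (no ¬p) (yes q) (no _) (no _) eq =
      <-≤-trans (proj₂ (bound (λ w → M + rank ε w)) v) (m≤m+n N _)
    desc {v = v} Wu Wv uv (no ¬p) (no ¬q) (yes _) _ eq =
      <-≤-trans (proj₂ (bound (rank γ)) v) (m≤m+n M _)
    desc Wu Wv uv (no ¬p) (no ¬q) (no ¬p′) (yes q) eq =
      contradiction uv (in′ (Wu , ¬p , ¬q) Wv ¬p′ q)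
    desc Wu Wv uv (no ¬p) (no ¬q) (no ¬p′) (no ¬q′) eq =
      +-monoʳ-< M (descends ε (Wu , ¬p , ¬q) (Wv , ¬p′ , ¬q′) uv eq)

-- Reachability, parities of walks, and graphs without odd closed walks.

-- Floyd–Warshall: the intermediate vertices are taken from a list.
module _ {A : Set} (R : Rel A 0ℓ) where

  Via : List A → Rel A 0ℓ
  Via []       a b = R a b
  Via (x ∷ xs) a b = Via xs a b ⊎ (Via xs a x × Via xs x b)

  via? : Binary.Decidable R → ∀ xs → Binary.Decidable (Via xs)
  via? R? []       a b = R? a b
  via? R? (x ∷ xs) a b = via? R? xs a b ⊎-dec (via? R? xs a x ×-dec via? R? xs x b)

  via-arc : ∀ xs {a b} → R a b → Via xs a b
  via-arc []       r = r
  via-arc (x ∷ xs) r = inj₁ (via-arc xs r)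

  -- If the junction is the head of the list, each half is cut at its visit there; otherwise a
  -- detour between two visits to the head is dropped.
  via-trans : ∀ {xs a x b} → x ∈ xs → Via xs a x → Via xs x b → Via xs a b
  via-trans (here refl) (inj₁ p)       (inj₁ q)       = inj₂ (p , q)
  via-trans (here refl) (inj₁ p)       (inj₂ (_ , q)) = inj₂ (p , q)
  via-trans (here refl) (inj₂ (p , _)) (inj₁ q)       = inj₂ (p , q)
  via-trans (here refl) (inj₂ (p , _)) (inj₂ (_ , q)) = inj₂ (p , q)
  via-trans (there x∈)  (inj₁ p)       (inj₁ q)       = inj₁ (via-trans x∈ p q)
  via-trans (there x∈)  (inj₁ p)       (inj₂ (q , r)) = inj₂ (via-trans x∈ p q , r)
  via-trans (there x∈)  (inj₂ (p , q)) (inj₁ r)       = inj₂ (p , via-trans x∈ q r)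
  via-trans (there x∈)  (inj₂ (p , _)) (inj₂ (_ , r)) = inj₂ (p , r)

  via-least : ∀ {S : Rel A 0ℓ} → (∀ {a b} → R a b → S a b) →
    (∀ {a b c} → S a b → S b c → S a c) → ∀ xs {a b} → Via xs a b → S a b
  via-least R⊆S S-trans []       p              = R⊆S p
  via-least R⊆S S-trans (x ∷ xs) (inj₁ p)       = via-least R⊆S S-trans xs p
  via-least R⊆S S-trans (x ∷ xs) (inj₂ (p , q)) =
    S-trans (via-least R⊆S S-trans xs p) (via-least R⊆S S-trans xs q)

module Walks {n : ℕ} (R : Rel (Fin n) 0ℓ) (R? : Binary.Decidable R) where

  data Walk : ℕ → Rel (Fin n) 0ℓ where
    []  : ∀ {u} → Walk 0 u u
    _∷_ : ∀ {k u v w} → R u v → Walk k v w → Walk (suc k) u w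

  _++_ : ∀ {j k u v w} → Walk j u v → Walk k v w → Walk (j + k) u w
  []      ++ q = q
  (e ∷ p) ++ q = e ∷ (p ++ q)

  walk? : ∀ k → Binary.Decidable (Walk k)
  walk? zero    u w = map′ (λ { refl → [] }) (λ { [] → refl }) (u Fin.≟ w)
  walk? (suc k) u w = map′ (λ (v , e , p) → e ∷ p) (λ { (e ∷ p) → _ , e , p })
    (any? λ v → R? u v ×-dec walk? k v w)

  OddClosed : Pred ℕ 0ℓ
  OddClosed k = parity k ≡ 1ℙ × ∃ λ v → Walk k v v

  oddClosed? : Decidable OddClosed
  oddClosed? k = (parity k ℙ.≟ 1ℙ) ×-dec any? λ v → walk? k v v

  Linked : Parity → Rel (Fin n) 0ℓ
  Linked p u v = ∃ λ k → parity (suc k) ≡ p × Walk (suc k) u v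

  arc-linked : ∀ {u v} → R u v → Linked 1ℙ u v
  arc-linked e = 0 , refl , e ∷ []

  link : ∀ {p q u v w} → Linked p u v → Linked q v w → Linked (p ℙ.+ q) u w
  link (j , refl , π) (k , refl , κ) =
    j + suc k , ℙ.+-homo-+ (suc j) (suc k) , π ++ κ

  private
    -- Arcs of the bipartite double cover: a walk of parity p from u to v is reachability from (u ,
    -- 0ℙ) to (v , p), a finite question.
    Step : Rel (Fin n × Parity) 0ℓ
    Step (u , p) (v , q) = R u v × q ≡ p ℙ.⁻¹

    all : List (Fin n × Parity)
    all = cartesianProduct (allFin n) (0ℙ ∷ 1ℙ ∷ [])

    complete : ∀ x → x ∈ all
    complete (v , 0ℙ) = ∈-cartesianProduct⁺ (∈-allFin v) (here refl)
    complete (v , 1ℙ) = ∈-cartesianProduct⁺ (∈-allFin v) (there (here refl))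

    Track : Rel (Fin n × Parity) 0ℓ
    Track (u , p) (v , q) = Linked (p ℙ.+ q) u v

    telescope : ∀ p q r → (p ℙ.+ q) ℙ.+ (q ℙ.+ r) ≡ p ℙ.+ r
    telescope p q r = begin
      (p ℙ.+ q) ℙ.+ (q ℙ.+ r) ≡⟨ ℙ.+-assoc p q (q ℙ.+ r) ⟩
      p ℙ.+ (q ℙ.+ (q ℙ.+ r)) ≡⟨ cong (p ℙ.+_) (ℙ.+-assoc q q r) ⟨
      p ℙ.+ ((q ℙ.+ q) ℙ.+ r) ≡⟨ cong (λ x → p ℙ.+ (x ℙ.+ r)) (ℙ.p+p≡0ℙ q) ⟩
      p ℙ.+ r                 ∎
      where open ≡-Reasoning

    sound : ∀ {x y} → Via Step all x y → Track x y
    sound = via-least Step step-track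
      (λ { {u , p} {v , q} {w , r} π κ →
           subst (λ s → Linked s u w) (telescope p q r) (link π κ) }) all
      where
      step-track : ∀ {x y} → Step x y → Track x y
      step-track {u , 0ℙ} (e , refl) = arc-linked e
      step-track {u , 1ℙ} (e , refl) = arc-linked e

    flips : ∀ {k u v} → Walk (suc k) u v → ∀ p → Via Step all (u , p) (v , parity (suc k) ℙ.+ p)
    flips (e ∷ []) 0ℙ = via-arc Step all (e , refl)
    flips (e ∷ []) 1ℙ = via-arc Step all (e , refl)
    flips {suc k} (e ∷ π@(_ ∷ _)) p =
      via-trans Step (complete (_ , p ℙ.⁻¹)) (via-arc Step all (e , refl))
        (subst (λ q → Via Step all _ (_ , q)) (shift k p) (flips π (p ℙ.⁻¹)))
      where
      shift : ∀ k p → parity (suc k) ℙ.+ p ℙ.⁻¹ ≡ parity (suc (suc k)) ℙ.+ p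
      shift k p rewrite sym (ℙ.suc-homo-⁻¹ k) with parity (suc k)
      shift k p | 0ℙ = refl
      shift k p | 1ℙ = ℙ.⁻¹-involutive p

  linked? : ∀ p → Binary.Decidable (Linked p)
  linked? p u v = map′ sound
    (λ { (k , refl , π) → subst (λ q → Via Step all (u , 0ℙ) (v , q)) (ℙ.+-identityʳ _) (flips π 0ℙ) })
    (via? Step (λ (u , p) (v , q) → R? u v ×-dec (q ℙ.≟ p ℙ.⁻¹)) all (u , 0ℙ) (v , p))

  Joined : Rel (Fin n) 0ℓ
  Joined u v = ∃ λ p → Linked p u v

  joined? : Binary.Decidable Joined
  joined? u v = map′ (λ { (inj₁ π) → 0ℙ , π ; (inj₂ π) → 1ℙ , π })
    (λ { (0ℙ , π) → inj₁ π ; (1ℙ , π) → inj₂ π }) (linked? 0ℙ u v ⊎-dec linked? 1ℙ u v)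

  -- Colour v by the parity of the walks from v to the least vertex of its strong component.
  bipartite : (∀ v → ¬ Linked 1ℙ v v) → Colouring R 2 U
  bipartite no-odd = record
    { colour = λ v → col (even? v) ; rank = rk
    ; descends = λ {u} {v} _ _ e eq → desc e eq (joined? v u) }
    where
    Mutual : Parity → Rel (Fin n) 0ℓ
    Mutual p v w = Linked p v w × Joined w v
    -- A vertex on no closed walk has no root and is not `Even`; all its arcs leave its strong
    -- component.
    Root : Fin n → Pred ℕ 0ℓ
    Root v i = ∃ λ w → toℕ w ≡ i × Joined v w × Joined w v
    root? : ∀ v → Decidable (Root v)
    root? v i = any? λ w → (toℕ w ≟ i) ×-dec joined? v w ×-dec joined? w v
    root : Fin n → ℕ
    root v = first (root? v) n
    Even : Pred (Fin n) 0ℓ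
    Even v = ∃ λ w → toℕ w ≡ root v × Mutual 0ℙ v w
    even? : Decidable Even
    even? v = any? λ w → (toℕ w ≟ root v) ×-dec linked? 0ℙ v w ×-dec joined? w v
    col : ∀ {v} → Dec (Even v) → Fin 2
    col (yes _) = zero
    col (no _)  = suc zero
    Reaches : Rel (Fin n) 0ℓ
    Reaches v w = v ≡ w ⊎ Joined v w
    reaches? : Binary.Decidable Reaches
    reaches? v w = (v Fin.≟ w) ⊎-dec joined? v w
    -- The number of reachable vertices drops along arcs that leave a strong component; inside a
    -- component the colours alternate.
    rk : Fin n → ℕ
    rk v = length (filter (reaches? v) (allFin n))

    closed : ∀ {p v} → Linked p v v → p ≡ 0ℙ
    closed {0ℙ} π = refl
    closed {1ℙ} π = contradiction π (no-odd _)

    -- Two closed walks whose parities differ cannot both be even.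
    unambiguous : ∀ {v w} → Mutual 0ℙ v w → ¬ Linked 1ℙ v w
    unambiguous (π , q , κ) σ with () ←
      ℙ.+-cancelʳ-≡ q 0ℙ 1ℙ (trans (closed (link π κ)) (sym (closed (link σ κ))))

    root-mono : ∀ {u v} → Joined u v → Joined v u → root u ≤ root v
    root-mono {u} {v} (p , π) (q , κ) =
      let w , eq , (r , vw) , (s , wv) =
            first-holds (root? v) n (v , refl , (_ , link κ π) , (_ , link κ π)) (<⇒≤ (Fin.toℕ<n v))
      in first-minimal (root? u) n (w , eq , (_ , link π vw) , (_ , link wv κ))

    alternate : ∀ {u v} → R u v → Joined v u → (eu : Dec (Even u)) (ev : Dec (Even v)) →
      col eu ≢ col ev
    alternate {u} {v} e (b , κ) eu ev same = go eu ev same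
      where
      roots : root u ≡ root v
      roots = ≤-antisym (root-mono (_ , arc-linked e) (b , κ)) (root-mono (b , κ) (_ , arc-linked e))
      -- The walk back closes the arc from u to v to an even walk, so it is odd.
      b≡1ℙ : b ≡ 1ℙ
      b≡1ℙ = sym (ℙ.⁻¹-injective (sym (closed (link (arc-linked e) κ))))
      go : (eu : Dec (Even u)) (ev : Dec (Even v)) → col eu ≢ col ev
      go (yes (w , iw , π , _)) (yes (w′ , iw′ , μ)) _ with refl ← b≡1ℙ
        with refl ← Fin.toℕ-injective (trans iw (trans roots (sym iw′))) =
        unambiguous μ (link κ π)
      -- Since u is not `Even`, its walk to the root is odd; prefixed with the odd walk from v to u
      -- it makes v `Even`.
      go (no ¬eu) (no ¬ev) _
        with first-holds (root? u) n (u , refl , (_ , link (arc-linked e) κ) , (_ , link (arc-linked e) κ))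
               (<⇒≤ (Fin.toℕ<n u))
      ... | w , iw , (0ℙ , π) , back = ¬eu (w , iw , π , back)
      ... | w , iw , (1ℙ , π) , (q , σ) with refl ← b≡1ℙ =
        ¬ev (w , trans iw roots , link κ π , _ , link σ (arc-linked e))

    desc : ∀ {u v} → R u v → col (even? u) ≡ col (even? v) → Dec (Joined v u) → rk v < rk u
    desc {u} {v} e eq (yes back) = contradiction eq (alternate e back (even? u) (even? v))
    desc {u} {v} e eq (no ¬back) =
      count-mono-< (reaches? v) (reaches? u)
        (λ { (inj₁ refl) → inj₂ (_ , arc-linked e) ; (inj₂ (_ , π)) → inj₂ (_ , link (arc-linked e) π) })
        (∈-allFin u)
        (λ { (inj₁ refl) → no-odd _ (arc-linked e) ; (inj₂ π) → ¬back π })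
        (inj₁ refl)

-- Closed walks as periodic sequences, and parity arithmetic.

record Circuit {n : ℕ} (R : Rel (Fin n) 0ℓ) (ℓ : ℕ) : Set where
  field
    at     : ℕ → Fin n
    arc    : ∀ i → R (at i) (at (suc i))
    period : ∀ i → at (i + ℓ) ≡ at i

  wrap : ∀ i q → at (i + q * ℓ) ≡ at i
  wrap i zero    = cong at (+-identityʳ i)
  wrap i (suc q) = begin
    at (i + (ℓ + q * ℓ)) ≡⟨ cong (λ x → at (i + x)) (+-comm ℓ (q * ℓ)) ⟩
    at (i + (q * ℓ + ℓ)) ≡⟨ cong at (+-assoc i (q * ℓ) ℓ) ⟨
    at (i + q * ℓ + ℓ)   ≡⟨ period (i + q * ℓ) ⟩
    at (i + q * ℓ)       ≡⟨ wrap i q ⟩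
    at i                 ∎
    where open ≡-Reasoning

  reduce : ∀ .{{_ : NonZero ℓ}} i → at (i % ℓ) ≡ at i
  reduce i = sym (trans (cong at (m≡m%n+[m/n]*n i ℓ)) (wrap (i % ℓ) (i / ℓ)))

module _ {n : ℕ} {R : Rel (Fin n) 0ℓ} {R? : Binary.Decidable R} where
  open Walks R R?

  -- Iterates a machine that drops the first arc of the remaining walk and reloads the full walk
  -- once nothing is left.
  unroll : ∀ {k v} → Walk (suc k) v v → Circuit R (suc k)
  unroll {k} {v} walk = record { at = source ∘ state ; arc = step ∘ state ; period = λ i →
      cong source (trans (fold-+ full next i) (cong (λ s → fold s next i) (return k walk))) }
    where
    State : Set
    State = ∃₂ λ j u → Walk (suc j) u v
    full : State
    full = k , v , walk
    source : State → Fin n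
    source (_ , u , _) = u
    next : State → State
    next (_ , _ , e ∷ [])          = full
    next (_ , _ , e ∷ π@(_ ∷ _)) = _ , _ , π
    step : ∀ s → R (source s) (source (next s))
    step (_ , _ , e ∷ [])      = e
    step (_ , _ , e ∷ (_ ∷ _)) = e
    state : ℕ → State
    state = fold full next
    return : ∀ j {u} (π : Walk (suc j) u v) → fold (j , u , π) next (suc j) ≡ full
    return zero    (e ∷ [])          = refl
    return (suc j) (e ∷ π@(_ ∷ _)) =
      trans (trans (cong (fold _ next) (+-comm 1 (suc j))) (fold-+ _ next (suc j))) (return j π)

odd-half : ∀ m → parity m ≡ 1ℙ → ∃ λ k → m ≡ suc (k * 2)
odd-half (suc zero)    _   = 0 , refl
odd-half (suc (suc m)) odd = let k , eq = odd-half m odd in suc k , cong (2 +_) eq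

parity-∸ : ∀ {i k} → i ≤ k → parity (k ∸ i) ≡ 0ℙ → parity k ≡ parity i
parity-∸ {i} {k} i≤k even = begin
  parity k                       ≡⟨ cong parity (m∸n+n≡m i≤k) ⟨
  parity (k ∸ i + i)             ≡⟨ ℙ.+-homo-+ (k ∸ i) i ⟩
  parity (k ∸ i) ℙ.+ parity i    ≡⟨ cong (ℙ._+ parity i) even ⟩
  parity i                       ∎
  where open ≡-Reasoning

parity-∸⁻¹ : ∀ {i k} → i ≤ k → parity k ≡ parity i → parity (k ∸ i) ≡ 0ℙ
parity-∸⁻¹ {i} {k} i≤k eq = ℙ.+-cancelʳ-≡ (parity i) _ _
  (trans (sym (ℙ.+-homo-+ (k ∸ i) i)) (trans (cong parity (m∸n+n≡m i≤k)) eq))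

not-odd : ∀ {p} → p ≢ 1ℙ → p ≡ 0ℙ
not-odd {0ℙ} _  = refl
not-odd {1ℙ} ¬1 = contradiction refl ¬1

-- Induced paths, P₆-freeness and triangle-freeness.

module _ (D : Digraph) (oriented : Oriented D) where

  InducedPath : ∀ {k} → Vec (Fin (n D)) k → Set
  InducedPath []           = ⊤
  InducedPath (u ∷ [])     = ⊤
  InducedPath (u ∷ v ∷ vs) = Arc D u v × All (λ w → ¬ Adj D u w) vs × InducedPath (v ∷ vs)

  induced-arcs : ∀ {k} (vs : Vec (Fin (n D)) k) → InducedPath vs →
    ∀ i j → Arc D (lookup vs i) (lookup vs j) ⇔ (toℕ j ≡ suc (toℕ i))
  induced-arcs (u ∷ _) _ zero zero = mk⇔ (λ e → contradiction e (proj₁ oriented u)) λ ()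
  induced-arcs (u ∷ v ∷ vs) (uv , _ , _) zero (suc zero) = mk⇔ (λ _ → refl) (λ _ → uv)
  induced-arcs (u ∷ v ∷ vs) (_ , far , _) zero (suc (suc j)) =
    mk⇔ (λ e → contradiction (inj₁ e) (lookup⁺ far j)) λ ()
  induced-arcs (u ∷ v ∷ vs) (uv , _ , _) (suc zero) zero =
    mk⇔ (λ e → contradiction e (proj₂ oriented u v uv)) λ ()
  induced-arcs (u ∷ v ∷ vs) (_ , far , _) (suc (suc i)) zero =
    mk⇔ (λ e → contradiction (inj₂ e) (lookup⁺ far i)) λ ()
  induced-arcs (u ∷ v ∷ vs) (_ , _ , path) (suc i) (suc j) =
    let open Equivalence (induced-arcs (v ∷ vs) path i j) in
    mk⇔ (λ e → cong suc (to e)) (λ eq → from (suc-injective eq))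

  -- Distinctness follows from the arcs: if positions i < j held the same vertex, position i + 1
  -- would also be the successor of j.
  induced-P6 : (vs : Vec (Fin (n D)) 6) → InducedPath vs → ContainsInducedP6 D
  induced-P6 vs path = lookup vs , (λ {i} {j} → injective i j) , induced-arcs vs path
    where
    successor : ∀ (i j : Fin 6) → lookup vs i ≡ lookup vs j → ∀ k →
      toℕ k ≡ suc (toℕ i) → toℕ k ≡ suc (toℕ j)
    successor i j eq k k≡ = Equivalence.to (induced-arcs vs path j k)
      (subst (λ x → Arc D x (lookup vs k)) eq (Equivalence.from (induced-arcs vs path i k) k≡))
    smaller : ∀ (i j : Fin 6) → lookup vs i ≡ lookup vs j → ¬ toℕ i < toℕ j
    smaller i j eq i<j = <⇒≢ i<j (suc-injective (trans (sym k≡) (successor i j eq k k≡)))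
      where
      k = Fin.fromℕ< (≤-<-trans i<j (Fin.toℕ<n j))
      k≡ = Fin.toℕ-fromℕ< (≤-<-trans i<j (Fin.toℕ<n j))
    injective : ∀ i j → lookup vs i ≡ lookup vs j → i ≡ j
    injective i j eq with <-cmp (toℕ i) (toℕ j)
    ... | Binary.tri< i<j _ _ = contradiction i<j (smaller i j eq)
    ... | Binary.tri≈ _ i≡j _ = Fin.toℕ-injective i≡j
    ... | Binary.tri> _ _ j<i = contradiction j<i (smaller j i (sym eq))

  ranked-acyclic : ∀ {S : Pred (Fin (n D)) 0ℓ} (ρ : Fin (n D) → ℕ) →
    (∀ {u v} → S u → S v → Arc D u v → ρ v < ρ u) → Acyclic D S
  ranked-acyclic ρ desc (k , c , _ , Sc , arcs , closing) =
    <⇒≱ (desc (Sc (Fin.fromℕ k)) (Sc zero) closing) (descent k (ρ ∘ c) (λ i → desc (Sc _) (Sc _) (arcs i)))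
    where
    descent : ∀ k (r : Fin (suc k) → ℕ) → (∀ (i : Fin k) → r (suc i) < r (Fin.inject₁ i)) →
      r (Fin.fromℕ k) ≤ r zero
    descent zero    r _    = ≤-refl
    descent (suc k) r step = ≤-trans (descent k (r ∘ suc) (step ∘ suc)) (<⇒≤ (step zero))

module Context (D : Digraph) (oriented : Oriented D) (P6-free : ¬ ContainsInducedP6 D)
               (triangle-free : TriangleFree D) where

  V : Set
  V = Fin (n D)

  E : Rel V 0ℓ
  E = Arc D

  infix 4 _~_ _~?_
  _~_ : Rel V 0ℓ
  _~_ = Adj D

  _~?_ : Binary.Decidable _~_
  u ~? v = arc? D u v ⊎-dec arc? D v u

  apart : ∀ {u v w} → u ~ v → v ~ w → ¬ u ~ w
  apart uv vw uw = triangle-free _ _ _ uv vw uw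

  only-into : ∀ {u v} → u ~ v → ¬ E u v → E v u
  only-into (inj₁ uv) ¬uv = contradiction uv ¬uv
  only-into (inj₂ vu) _   = vu

  -- Of the ten non-consecutive pairs, the four at distance two are non-adjacent by `apart` and five
  -- by hypothesis; only c, f is left as a chord.
  no-P6 : ∀ {a b c d e f} → E a b → E b c → E c d → E d e → E e f →
    ¬ a ~ d → ¬ a ~ e → ¬ a ~ f → ¬ b ~ e → ¬ b ~ f → ¬ ¬ c ~ f
  no-P6 {a} {b} {c} {d} {e} {f} ab bc cd de ef ad ae af be bf cf =
    P6-free (induced-P6 D oriented (a ∷ b ∷ c ∷ d ∷ e ∷ f ∷ [])
      ( ab , apart (inj₁ ab) (inj₁ bc) ∷ ad ∷ ae ∷ af ∷ []
      , bc , apart (inj₁ bc) (inj₁ cd) ∷ be ∷ bf ∷ []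
      , cd , apart (inj₁ cd) (inj₁ de) ∷ cf ∷ []
      , de , apart (inj₁ de) (inj₁ ef) ∷ []
      , ef , [] , tt))

  after-tail : ∀ {a b x z₀ z₁ z₂} → E a b → E b x → E x z₀ → E z₀ z₁ → E z₁ z₂ →
    ¬ a ~ z₀ → ¬ a ~ z₁ → ¬ a ~ z₂ → ¬ b ~ z₁ → ¬ b ~ z₂ → x ~ z₂
  after-tail ab bx xz₀ z₀z₁ z₁z₂ az₀ az₁ az₂ bz₁ bz₂ =
    decidable-stable (_ ~? _) (no-P6 ab bx xz₀ z₀z₁ z₁z₂ az₀ az₁ az₂ bz₁ bz₂)

  before-head : ∀ {a b x z₀ z₁ z₂} → E z₂ z₁ → E z₁ z₀ → E z₀ x → E x b → E b a →
    ¬ a ~ z₀ → ¬ a ~ z₁ → ¬ a ~ z₂ → ¬ b ~ z₁ → ¬ b ~ z₂ → x ~ z₂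
  before-head z₂z₁ z₁z₀ z₀x xb ba az₀ az₁ az₂ bz₁ bz₂ =
    -- In this direction the undecided pair is the first and the fourth vertex of the path.
    decidable-stable (_ ~? _) λ xz₂ → no-P6 z₂z₁ z₁z₀ z₀x xb ba
      (xz₂ ∘ swap) (bz₂ ∘ swap) (az₂ ∘ swap) (bz₁ ∘ swap) (az₁ ∘ swap) (az₀ ∘ swap)

-- A shortest odd closed walk and the far vertices.

module Around (D : Digraph) (oriented : Oriented D) (P6-free : ¬ ContainsInducedP6 D)
  (triangle-free : TriangleFree D) {W : Pred (Fin (n D)) 0ℓ} (W? : Decidable W)
  where

  open Context D oriented P6-free triangle-free

  Inner : Rel V 0ℓ
  Inner u v = W u × W v × E u v

  inner? : Binary.Decidable Inner
  inner? u v = W? u ×-dec W? v ×-dec arc? D u v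

  open Walks Inner inner?

  module Peel (k : ℕ) (circuit : Circuit Inner (suc (k * 2)))
    (shortest : ∀ {m v} → m < suc (k * 2) → parity m ≡ 1ℙ → ¬ Walk m v v) where

    ℓ : ℕ
    ℓ = suc (k * 2)

    open Circuit circuit renaming (at to c)

    cW : ∀ i → W (c i)
    cW i = proj₁ (arc i)

    cE : ∀ i → E (c i) (c (suc i))
    cE i = proj₂ (proj₂ (arc i))

    segment : ∀ j i → Walk j (c i) (c (j + i))
    segment zero    i = []
    segment (suc j) i = arc i ∷ subst (λ m → Walk j (c (suc i)) (c m)) (+-suc j i) (segment j (suc i))

    chord : ∀ {i j} → i ≤ j → Walk (j ∸ i) (c i) (c j)
    chord {i} {j} i≤j = subst (λ x → Walk (j ∸ i) (c i) (c x)) (m∸n+n≡m i≤j) (segment (j ∸ i) i)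

    closed-even : ∀ {m v} → m < ℓ → Walk m v v → parity m ≡ 0ℙ
    closed-even m<ℓ π = not-odd λ odd → shortest m<ℓ odd π

    Near X⁺ X⁻ Far : Pred V 0ℓ
    Near v = ∃ λ i → i < ℓ × c i ~ v
    X⁺ v   = ∃ λ i → i < ℓ × E (c i) v
    X⁻ v   = ∃ λ i → i < ℓ × E v (c i)
    Far    = W ∩ ∁ Near

    near? : Decidable Near
    near? v = anyUpTo? (λ i → c i ~? v) ℓ
    x⁺? : Decidable X⁺
    x⁺? v = anyUpTo? (λ i → arc? D (c i) v) ℓ
    x⁻? : Decidable X⁻
    x⁻? v = anyUpTo? (λ i → arc? D v (c i)) ℓ
    far? : Decidable Far
    far? v = W? v ×-dec ¬? (near? v)

    -- By periodicity any index may stand for one below `ℓ`, the bound that keeps `Near`, `X⁺` and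
    -- `X⁻` decidable.
    within : ∀ {P : Pred V 0ℓ} i → P (c i) → ∃ λ j → j < ℓ × P (c j)
    within {P} i p = i % ℓ , m%n<n i ℓ , subst P (sym (reduce i)) p

    far : ∀ {v} → Far v → ∀ i → ¬ c i ~ v
    far (_ , ¬near) i iv = ¬near (within {λ b → b ~ _} i iv)

    -- Index i + k * 2 plays the role of i - 1: one more step gives i + `ℓ`.
    predecessor : ∀ i → E (c (i + k * 2)) (c i)
    predecessor i = subst (E _) (trans (cong c (sym (+-suc i (k * 2)))) (period i)) (cE (i + k * 2))

    -- The arc of c into an in-neighbour of x, followed by x and the far path, has six vertices; x
    -- and z₂ form its only possible chord.
    forward : ∀ {x z₀ z₁ z₂} → X⁺ x → Far z₀ → Far z₁ → Far z₂ →
      E x z₀ → E z₀ z₁ → E z₁ z₂ → x ~ z₂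
    forward (i , _ , ix) f₀ f₁ f₂ xz₀ z₀z₁ z₁z₂ =
      after-tail (predecessor i) ix xz₀ z₀z₁ z₁z₂ (far f₀ _) (far f₁ _) (far f₂ _) (far f₁ _) (far f₂ _)

    backward : ∀ {x z₀ z₁ z₂} → X⁻ x → Far z₀ → Far z₁ → Far z₂ →
      E z₂ z₁ → E z₁ z₀ → E z₀ x → x ~ z₂
    backward (i , _ , xi) f₀ f₁ f₂ z₂z₁ z₁z₀ z₀x =
      before-head z₂z₁ z₁z₀ z₀x xi (cE i) (far f₀ _) (far f₁ _) (far f₂ _) (far f₁ _) (far f₂ _)

    around : ∀ i → c (k * 2 + suc i) ≡ c i
    around i = trans (cong c turn) (period i)
      where
      turn : k * 2 + suc i ≡ i + ℓ
      turn = trans (+-suc (k * 2) i) (+-comm ℓ i)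

    consecutive-apart : ∀ {x} i → c i ~ x → ¬ c (suc i) ~ x
    consecutive-apart i ix sx = apart (inj₁ (cE i)) sx ix

    -- Without an arc from c j to x, the path c j, c (j + 1), c (j + 2), x, z₀, z₁ would be induced.
    -- So in-neighbours of x on c propagate two steps back; as c is odd, k such moves lead from c i
    -- to c (i + 1), which closes a triangle.
    source-stops : ∀ {x z₀ z₁} → X⁺ x → ¬ X⁻ x → Far z₀ → Far z₁ → E x z₀ → ¬ E z₀ z₁
    source-stops {x} {z₀} {z₁} (i , _ , ix) ¬x⁻ f₀ f₁ xz₀ z₀z₁ =
      consecutive-apart i (inj₁ ix) (inj₁ (descend k (suc i) (subst (λ b → E b x) (sym (around i)) ix)))
      where
      arcs-in : ∀ j → c j ~ x → E (c j) x
      arcs-in j (inj₁ e) = e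
      arcs-in j (inj₂ e) = contradiction (within {λ b → E x b} j e) ¬x⁻
      back-two : ∀ j → E (c (2 + j)) x → E (c j) x
      back-two j e = arcs-in j (decidable-stable (c j ~? x) λ jx →
        no-P6 (cE j) (cE (suc j)) e xz₀ z₀z₁ jx
          (far f₀ j) (far f₁ j) (far f₀ (suc j)) (far f₁ (suc j)) (far f₁ (2 + j)))
      descend : ∀ m j → E (c (m * 2 + j)) x → E (c j) x
      descend zero    j e = e
      descend (suc m) j e = descend m j (back-two (m * 2 + j) e)

    sink-stops : ∀ {x z₀ z₁} → ¬ X⁺ x → X⁻ x → Far z₀ → Far z₁ → E z₁ z₀ → ¬ E z₀ x
    sink-stops {x} {z₀} {z₁} ¬x⁺ (i , _ , xi) f₀ f₁ z₁z₀ z₀x =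
      consecutive-apart i (inj₂ xi) (inj₂ (subst (λ b → E x b) once (ascend (suc k) i xi)))
      where
      -- Going forwards takes k + 1 double steps, that is `ℓ` + 1 single ones.
      once : c (suc k * 2 + i) ≡ c (suc i)
      once = trans (cong c (sym (trans (+-suc (k * 2) (suc i)) (cong suc (+-suc (k * 2) i))))) (around (suc i))
      arcs-out : ∀ j → c j ~ x → E x (c j)
      arcs-out j (inj₁ e) = contradiction (within {λ b → E b x} j e) ¬x⁺
      arcs-out j (inj₂ e) = e
      on-two : ∀ j → E x (c j) → E x (c (2 + j))
      on-two j e = arcs-out (2 + j) (decidable-stable (c (2 + j) ~? x) λ jx →
        no-P6 z₁z₀ z₀x e (cE j) (cE (suc j)) (far f₁ j ∘ swap) (far f₁ (suc j) ∘ swap)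
          (far f₁ (2 + j) ∘ swap) (far f₀ (suc j) ∘ swap) (far f₀ (2 + j) ∘ swap) (jx ∘ swap))
      ascend : ∀ m j → E x (c j) → E x (c (m * 2 + j))
      ascend zero    j e = e
      ascend (suc m) j e = on-two (m * 2 + j) (ascend m j e)

    -- Ten colours for the neighbourhood of the walk.

    g h : V → ℕ
    -- `first` leaves its bound untested while `last` includes it, so both searches run over c 0,
    -- ..., c (k * 2).
    g v = first (λ i → c i ~? v) ℓ
    h v = last (λ i → c i ~? v) (k * 2)

    -- Cutting off both ends of c 0, …, c (k * 2) leaves room for two arcs before c (g v) and after c (h v).
    Inside : Pred V 0ℓ
    Inside v = Near v × ¬ c 0 ~ v × ¬ c 1 ~ v × ¬ c (k * 2) ~ v × ¬ c (k * 2 ∸ 1) ~ v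

    g-holds : ∀ {v} → Near v → c (g v) ~ v
    g-holds (i , i<ℓ , iv) = first-holds (λ i → c i ~? _) ℓ iv (<⇒≤ i<ℓ)

    g-minimal : ∀ {v} i → c i ~ v → g v ≤ i
    g-minimal i iv = first-minimal (λ i → c i ~? _) ℓ iv

    below-g : ∀ {v} i → i < g v → ¬ c i ~ v
    below-g i i<g iv = <⇒≱ i<g (g-minimal i iv)

    h-holds : ∀ {v} → Near v → c (h v) ~ v
    h-holds (i , s≤s i≤ , iv) = last-holds (λ i → c i ~? _) (k * 2) iv i≤

    above-h : ∀ {v} i → i ≤ k * 2 → h v < i → ¬ c i ~ v
    above-h i i≤ h<i iv = <⇒≱ h<i (last-maximal (λ i → c i ~? _) (k * 2) iv i≤)

    h≤ : ∀ v → h v ≤ k * 2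
    h≤ v = last-bound (λ i → c i ~? v) (k * 2)

    g≤h : ∀ {v} → Near v → g v ≤ h v
    g≤h {v} near = g-minimal (h v) (h-holds near)

    g≥2 : ∀ {v} → Inside v → 2 ≤ g v
    g≥2 {v} (near , ¬0 , ¬1 , _) with g v | g-holds near
    ... | zero        | 0v = contradiction 0v ¬0
    ... | suc zero    | 1v = contradiction 1v ¬1
    ... | suc (suc _) | _  = s≤s (s≤s z≤n)

    h+2≤ : ∀ {v} → Inside v → 2 + h v ≤ k * 2
    h+2≤ {v} (near , _ , _ , ¬last , ¬prev) =
      ≤∧≢⇒< (≤∧≢⇒< (h≤ v) (λ eq → ¬last (subst (λ i → c i ~ v) eq (h-holds near))))
        (λ eq → ¬prev (subst (λ i → c i ~ v) (cong pred eq) (h-holds near)))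

    Starts Ends : Pred V 0ℓ
    Starts v = E (c (g v)) v
    Ends v   = E v (c (h v))
    starts? : Decidable Starts
    starts? v = arc? D (c (g v)) v
    ends? : Decidable Ends
    ends? v = arc? D v (c (h v))

    inside? : Decidable Inside
    inside? v = near? v ×-dec ¬? (c 0 ~? v) ×-dec ¬? (c 1 ~? v) ×-dec
      ¬? (c (k * 2) ~? v) ×-dec ¬? (c (k * 2 ∸ 1) ~? v)

    -- Adjacent vertices with equal `g` would form a triangle with c. If v and w both had larger
    -- labels than u, the two arcs of c into c (g u) followed by u, v, w would be an induced P₆, as
    -- minimality of `g` forbids every chord.
    starts-colouring : Colouring E 2 (Inside ∩ Starts)
    starts-colouring = labelled (λ v → inside? v ×-dec starts? v) (arc? D) g
      (λ { {u} {v} (_ , su) (_ , sv) uv eq →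
           apart (inj₁ su) (inj₁ uv) (inj₁ (subst (λ i → E (c i) v) (sym eq) sv)) })
      (λ { {u} {v} {w} (iu , su) _ _ uv vw gu<gv gu<gw → valley iu su uv vw gu<gv gu<gw })
      where
      valley : ∀ {u v w} → Inside u → Starts u → E u v → E v w → g u < g v → ¬ g u < g w
      valley {u} {v} {w} iu su uv vw gu<gv gu<gw = clean (g u ∸ 2) (m+[n∸m]≡n (g≥2 iu))
        where
        clean : ∀ i → 2 + i ≡ g u → ⊥
        clean i eq = below-g (g u) gu<gw (subst (λ j → c j ~ w) eq
          (after-tail (cE i) (cE (suc i)) (subst (λ j → E (c j) u) (sym eq) su) uv vw
            (below-g i i<gu) (below-g i (<-trans i<gu gu<gv)) (below-g i (<-trans i<gu gu<gw))
            (below-g (suc i) (<-trans 1+i<gu gu<gv)) (below-g (suc i) (<-trans 1+i<gu gu<gw))))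
          where
          1+i<gu : suc i < g u
          1+i<gu = ≤-reflexive eq
          i<gu : i < g u
          i<gu = <-trans (n<1+n i) 1+i<gu

    -- Reversing arcs and indices turns last neighbours into first ones.
    ends-colouring : Colouring E 2 (Inside ∩ Ends)
    ends-colouring = reverse (labelled (λ v → inside? v ×-dec ends? v) (flip (arc? D)) (λ v → k * 2 ∸ h v)
      (λ { {u} {v} (iu , eu) (iv , ev) vu eq → apart (inj₂ eu) (inj₂ vu)
            (inj₂ (subst (λ i → E v (c i)) (sym (∸-cancelˡ-≡ (h≤ u) (h≤ v) eq)) ev)) })
      (λ { (iu , eu) _ _ vu wv hu<hv hu<hw →
           valley iu eu vu wv (unflip hu<hv) (unflip hu<hw) }))
      where
      unflip : ∀ {a b} → k * 2 ∸ a < k * 2 ∸ b → b < a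
      unflip lt = ≰⇒> λ a≤b → <⇒≱ lt (∸-monoʳ-≤ (k * 2) a≤b)
      valley : ∀ {u v w} → Inside u → Ends u → E v u → E w v → h v < h u → ¬ h w < h u
      valley {u} {v} {w} iu eu vu wv hv<hu hw<hu =
        above-h (h u) (h≤ u) hw<hu (before-head wv vu eu (cE (h u)) (cE (suc (h u)))
          (above-h (2 + h u) (h+2≤ iu) (m≤n+m (suc (h u)) 1))
          (above-h (2 + h u) (h+2≤ iu) (m≤n⇒m≤o+n 2 hv<hu)) (above-h (2 + h u) (h+2≤ iu) (m≤n⇒m≤o+n 2 hw<hu))
          (above-h (1 + h u) h+1≤ (m≤n⇒m≤o+n 1 hv<hu)) (above-h (1 + h u) h+1≤ (m≤n⇒m≤o+n 1 hw<hu)))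
        where
        h+1≤ : suc (h u) ≤ k * 2
        h+1≤ = <⇒≤ (h+2≤ iu)

    Across : Pred V 0ℓ
    Across = W ∩ Inside ∩ ∁ Starts ∩ ∁ Ends

    inward : ∀ {v} → Across v → Inner v (c (g v))
    inward (Wv , (near , _) , ¬s , _) = Wv , cW _ , only-into (g-holds near) ¬s

    outward : ∀ {v} → Across v → Inner (c (h v)) v
    outward (Wv , (near , _) , _ , ¬e) = cW _ , Wv , only-into (swap (h-holds near)) ¬e

    -- Following c from c (g v) to c (h v) and returning through v takes h v - g v + 2 steps, fewer
    -- than `ℓ` because 2 ≤ g v; so short a closed walk is even.
    across-parity : ∀ {v} → Across v → parity (h v) ≡ parity (g v)
    across-parity {v} a@(_ , iv , _) = parity-∸ g≤ (trans (sym parity-+2) (closed-even short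
        (chord g≤ ++ (outward a ∷ inward a ∷ []))))
      where
      g≤ : g v ≤ h v
      g≤ = g≤h (proj₁ iv)
      parity-+2 : parity (h v ∸ g v + 2) ≡ parity (h v ∸ g v)
      parity-+2 = trans (ℙ.+-homo-+ (h v ∸ g v) 2) (ℙ.+-identityʳ _)
      short : h v ∸ g v + 2 < ℓ
      short = s≤s (begin
        h v ∸ g v + 2   ≤⟨ +-monoʳ-≤ (h v ∸ g v) (g≥2 iv) ⟩
        h v ∸ g v + g v ≡⟨ m∸n+n≡m g≤ ⟩
        h v             ≤⟨ h≤ v ⟩
        k * 2           ∎)
        where open ≤-Reasoning

    -- Within one parity class the whole span of v on c lies after that of u, so `h` increases along
    -- arcs.
    across-ascends : ∀ {u v} → Across u → Across v → E u v → parity (h u) ≡ parity (h v) → h u < h v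
    across-ascends {u} {v} a@(Wu , iu , _) b@(Wv , iv , _) uv same = <-≤-trans (≰⇒> ahead) (g≤h (proj₁ iv))
      where
      -- Otherwise c (g v) → ⋯ → c (h u) → u → v → c (g v) is a shorter odd closed walk.
      ahead : ¬ g v ≤ h u
      ahead g≤ = shortest short odd (chord g≤ ++ (outward a ∷ (Wu , Wv , uv) ∷ inward b ∷ []))
        where
        odd : parity (h u ∸ g v + 3) ≡ 1ℙ
        odd = trans (ℙ.+-homo-+ (h u ∸ g v) 3)
          (cong (ℙ._+ 1ℙ) (parity-∸⁻¹ g≤ (trans same (across-parity b))))
        short : h u ∸ g v + 3 < ℓ
        short = s≤s (begin
          h u ∸ g v + 3         ≤⟨ +-monoʳ-≤ (h u ∸ g v) (s≤s (g≥2 iv)) ⟩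
          h u ∸ g v + suc (g v) ≡⟨ +-suc (h u ∸ g v) (g v) ⟩
          suc (h u ∸ g v + g v) ≡⟨ cong suc (m∸n+n≡m g≤) ⟩
          suc (h u)             ≤⟨ <⇒≤ (h+2≤ iu) ⟩
          k * 2                 ∎)
          where open ≤-Reasoning

    across-colouring : Colouring E 2 Across
    across-colouring = separate (λ v → parity (h v) ℙ.≟ 0ℙ)
      (climbing λ (_ , p) (_ , q) → trans p (sym q))
      (climbing λ (_ , p) (_ , q) → trans (odd p) (sym (odd q)))
      where
      odd : ∀ {p} → p ≢ 0ℙ → p ≡ 1ℙ
      odd {0ℙ} ¬0 = contradiction refl ¬0
      odd {1ℙ} _  = refl
      climbing : ∀ {P : Pred V 0ℓ} →
        (∀ {u v} → (Across ∩ P) u → (Across ∩ P) v → parity (h u) ≡ parity (h v)) → Colouring E 1 (Across ∩ P)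
      climbing same = ranked (λ v → k * 2 ∸ h v) λ {u} {v} pu pv uv →
        ∸-monoʳ-< (across-ascends (proj₁ pu) (proj₁ pv) uv (same pu pv)) (h≤ v)

    near-colouring : Colouring E 10 (W ∩ Near)
    near-colouring =
      -- Four independent neighbourhoods take one colour each; `Starts`, `Ends` and `Across` take
      -- two each.
      separate (c 0 ~?_) (beside 0) (
      separate (c 1 ~?_) (beside 1) (
      separate (c (k * 2) ~?_) (beside (k * 2)) (
      separate (c (k * 2 ∸ 1) ~?_) (beside (k * 2 ∸ 1)) (
      separate starts? (restrict (λ (v , s) → inside v , s) starts-colouring) (
      separate ends? (restrict (λ ((v , _) , e) → inside v , e) ends-colouring)
        (restrict (λ ((v , ¬s) , ¬e) → proj₁ (proj₁ (proj₁ (proj₁ (proj₁ v)))) , inside v , ¬s , ¬e) across-colouring))))))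
      where
      beside : ∀ {P : Pred V 0ℓ} i → Colouring E 1 (P ∩ (c i ~_))
      beside i = independent λ (_ , iu) (_ , iv) uv → apart iu (inj₁ uv) iv
      inside : (((((W ∩ Near) ∩ ∁ (c 0 ~_)) ∩ ∁ (c 1 ~_)) ∩ ∁ (c (k * 2) ~_)) ∩ ∁ (c (k * 2 ∸ 1) ~_)) ⊆ Inside
      inside (((((_ , near) , ¬0) , ¬1) , ¬last) , ¬prev) = near , ¬0 , ¬1 , ¬last , ¬prev

    -- Far neighbours of vertices with arcs both to and from the walk.

    Mixed : Pred V 0ℓ
    Mixed m = W m × X⁺ m × X⁻ m
    mixed? : Decidable Mixed
    mixed? m = W? m ×-dec x⁺? m ×-dec x⁻? m

    Touched : Pred V 0ℓ
    Touched z = ∃ λ m → Mixed m × m ~ z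
    touched? : Decidable Touched
    touched? z = any? λ m → mixed? m ×-dec m ~? z

    Label : V → Pred ℕ 0ℓ
    Label z i = ∃ λ m → toℕ m ≡ i × Mixed m × m ~ z
    label? : ∀ z → Decidable (Label z)
    label? z i = any? λ m → (toℕ m ≟ i) ×-dec mixed? m ×-dec m ~? z

    label : V → ℕ
    label z = first (label? z) (n D)

    label-holds : ∀ {z} → Touched z → Label z (label z)
    label-holds (m , mm , mz) = first-holds (label? _) (n D) (m , refl , mm , mz) (<⇒≤ (Fin.toℕ<n m))

    label-minimal : ∀ {z m} → Mixed m → m ~ z → label z ≤ toℕ m
    label-minimal mm mz = first-minimal (label? _) (n D) (_ , refl , mm , mz)

    Fed Feeding : Pred V 0ℓ
    Fed z     = ∃ λ m → toℕ m ≡ label z × Mixed m × E m z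
    Feeding z = ∃ λ m → toℕ m ≡ label z × Mixed m × E z m
    fed? : Decidable Fed
    fed? z = any? λ m → (toℕ m ≟ label z) ×-dec mixed? m ×-dec arc? D m z
    feeding? : Decidable Feeding
    feeding? z = any? λ m → (toℕ m ≟ label z) ×-dec mixed? m ×-dec arc? D z m

    -- If m is the first mixed neighbour of u and m → u → v → w, then `forward` makes m adjacent to
    -- w, so the label of w is at most that of u.
    fed-colouring : Colouring E 2 (Far ∩ Fed)
    fed-colouring = labelled (λ v → far? v ×-dec fed? v) (arc? D) label
      (λ { (_ , m , m≡ , _ , mu) (_ , m′ , m′≡ , _ , m′v) uv eq →
           case Fin.toℕ-injective (trans m≡ (trans eq (sym m′≡))) of λ { refl →
             apart (inj₁ mu) (inj₁ uv) (inj₁ m′v) } })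
      (λ { (fu , m , m≡ , mm@(_ , x⁺ , _) , mu) (fv , _) (fw , _) uv vw _ lt →
           <⇒≱ (subst (_< _) (sym m≡) lt) (label-minimal mm (forward x⁺ fu fv fw mu uv vw)) })

    feeding-colouring : Colouring E 2 (Far ∩ Feeding)
    feeding-colouring = reverse (labelled (λ v → far? v ×-dec feeding? v) (flip (arc? D)) label
      (λ { (_ , m , m≡ , _ , um) (_ , m′ , m′≡ , _ , vm′) vu eq →
           case Fin.toℕ-injective (trans m≡ (trans eq (sym m′≡))) of λ { refl →
             apart (inj₂ um) (inj₂ vu) (inj₂ vm′) } })
      (λ { (fu , m , m≡ , mm@(_ , _ , x⁻) , um) (fv , _) (fw , _) vu wv _ lt →
           <⇒≱ (subst (_< _) (sym m≡) lt) (label-minimal mm (backward x⁻ fu fv fw wv vu um)) }))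

    -- The nice set.

    After Before : Pred V 0ℓ
    After z  = (∃₂ λ m o → Mixed m × Far o × E m o × E o z) ⊎ (∃ λ x → X⁺ x × ¬ X⁻ x × E x z)
    Before z = (∃₂ λ m o → Mixed m × Far o × E z o × E o m) ⊎ (∃ λ x → ¬ X⁺ x × X⁻ x × E z x)

    after? : Decidable After
    after? z = (any? λ m → any? λ o → mixed? m ×-dec far? o ×-dec arc? D m o ×-dec arc? D o z)
      ⊎-dec (any? λ x → x⁺? x ×-dec ¬? (x⁻? x) ×-dec arc? D x z)
    before? : Decidable Before
    before? z = (any? λ m → any? λ o → mixed? m ×-dec far? o ×-dec arc? D z o ×-dec arc? D o m)
      ⊎-dec (any? λ x → ¬? (x⁺? x) ×-dec x⁻? x ×-dec arc? D z x)

    -- If u is the second far vertex after a mixed m, `forward` makes m adjacent to v, which is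
    -- untouched. If u follows a vertex that only receives arcs from c, `source-stops` applies.
    after-out : ∀ {u v} → Far u → After u → Far v → ¬ Touched v → ¬ E u v
    after-out fu (inj₁ (m , o , mm@(_ , x⁺ , _) , fo , mo , ou)) fv ¬t uv = ¬t (m , mm , forward x⁺ fo fu fv mo ou uv)
    after-out fu (inj₂ (x , x⁺ , ¬x⁻ , xu)) fv _ uv = source-stops x⁺ ¬x⁻ fu fv xu uv

    before-in : ∀ {u v} → Far u → Before u → Far v → ¬ Touched v → ¬ E v u
    before-in fu (inj₁ (m , o , mm@(_ , _ , x⁻) , fo , uo , om)) fv ¬t vu = ¬t (m , mm , backward x⁻ fo fu fv vu uo om)
    before-in fu (inj₂ (x , ¬x⁺ , x⁻ , ux)) fv _ vu = sink-stops ¬x⁺ x⁻ fu fv vu ux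

    -- `S⁺` is built to send no arc to `Rest`. `S⁻` may be generous, since only its part outside
    -- `S⁺` has to receive no arc from `Rest`.
    S⁺ S⁻ : Pred V 0ℓ
    S⁺ v = (Near v × X⁺ v) ⊎ (¬ Near v × ((Touched v × Fed v) ⊎ (¬ Touched v × After v)))
    S⁻ v = Near v ⊎ Touched v ⊎ Before v

    s⁺? : Decidable S⁺
    s⁺? v = (near? v ×-dec x⁺? v) ⊎-dec
      (¬? (near? v) ×-dec ((touched? v ×-dec fed? v) ⊎-dec (¬? (touched? v) ×-dec after? v)))
    s⁻? : Decidable S⁻
    s⁻? v = near? v ⊎-dec touched? v ⊎-dec before? v

    Rest : Pred V 0ℓ
    Rest = W ∩ ∁ S⁺ ∩ ∁ S⁻

    rest-far : ∀ {v} → Rest v → Far v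
    rest-far (Wv , _ , ¬s⁻) = Wv , ¬s⁻ ∘ inj₁

    rest-untouched : ∀ {v} → Rest v → ¬ Touched v
    rest-untouched (_ , _ , ¬s⁻) = ¬s⁻ ∘ inj₂ ∘ inj₁

    rest-after : ∀ {v} → Rest v → ¬ After v
    rest-after r@(_ , ¬s⁺ , ¬s⁻) a = ¬s⁺ (inj₂ (¬s⁻ ∘ inj₁ , inj₂ (rest-untouched r , a)))

    rest-before : ∀ {v} → Rest v → ¬ Before v
    rest-before (_ , _ , ¬s⁻) = ¬s⁻ ∘ inj₂ ∘ inj₂

    unfed : ∀ {v} → Touched v → ¬ Fed v → Feeding v
    unfed t ¬fed = let m , m≡ , mm , mv = label-holds t in
      m , m≡ , mm , only-into mv λ e → ¬fed (m , m≡ , mm , e)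

    -- The head of such an arc would be `Touched` if u is mixed, and `After` if u only receives from
    -- c or is fed; `after-out` handles the other u.
    S⁺-closed : ∀ {u v} → W u → S⁺ u → Rest v → ¬ E u v
    S⁺-closed {u} Wu (inj₁ (_ , x⁺)) r uv with x⁻? u
    ... | yes x⁻ = rest-untouched r (u , (Wu , x⁺ , x⁻) , inj₁ uv)
    ... | no ¬x⁻ = rest-after r (inj₂ (u , x⁺ , ¬x⁻ , uv))
    S⁺-closed Wu (inj₂ (¬near , inj₁ (_ , m , _ , mm , mu))) r uv =
      rest-after r (inj₁ (m , _ , mm , (Wu , ¬near) , mu , uv))
    S⁺-closed Wu (inj₂ (¬near , inj₂ (_ , a))) r uv = after-out (Wu , ¬near) a (rest-far r) (rest-untouched r) uv

    S⁻-closed : ∀ {u v} → Rest u → W v → ¬ S⁺ v → S⁻ v → ¬ E u v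
    S⁻-closed {u} {v} r Wv ¬s⁺ s⁻ uv with near? v
    -- Being outside `S⁺` orients the arcs: a near v only sends arcs to c, and below a touched v
    -- feeds its first mixed neighbour. Either way u is `Before`.
    ... | yes near@(i , i<ℓ , iv) =
      rest-before r (inj₂ (v , ¬x⁺ , (i , i<ℓ , only-into iv λ e → ¬x⁺ (i , i<ℓ , e)) , uv))
      where
      ¬x⁺ : ¬ X⁺ v
      ¬x⁺ x⁺ = ¬s⁺ (inj₁ (near , x⁺))
    ... | no ¬near with touched? v
    ...   | yes t = let m , _ , mm , vm = unfed t λ fed → ¬s⁺ (inj₂ (¬near , inj₁ (t , fed))) in
      rest-before r (inj₁ (m , v , mm , (Wv , ¬near) , uv , vm))
    S⁻-closed r Wv ¬s⁺ (inj₁ near) uv | no ¬near | no _ = ¬near near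
    S⁻-closed r Wv ¬s⁺ (inj₂ (inj₁ t)) uv | no _ | no ¬t = ¬t t
    S⁻-closed r Wv ¬s⁺ (inj₂ (inj₂ b)) uv | no ¬near | no _ =
      before-in (Wv , ¬near) b (rest-far r) (rest-untouched r) uv

    S⁺-colouring : Colouring E 13 (W ∩ S⁺)
    S⁺-colouring =
      -- Ten colours for the near vertices, two for the fed ones, and one for the untouched `After`
      -- vertices, independent by `after-out`.
      separate near? (restrict (λ ((Wv , _) , near) → Wv , near) near-colouring) (
      separate touched? (restrict fed fed-colouring)
        (independent λ u v uv → let fu , _ , au = after u ; fv , ¬tv , _ = after v in after-out fu au fv ¬tv uv))
      where
      fed : (((W ∩ S⁺) ∩ ∁ Near) ∩ Touched) ⊆ (Far ∩ Fed)
      fed (((Wv , inj₁ (near , _)) , ¬near) , _) = contradiction near ¬near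
      fed (((Wv , inj₂ (_ , inj₁ (_ , f))) , ¬near) , _) = (Wv , ¬near) , f
      fed (((Wv , inj₂ (_ , inj₂ (¬t , _))) , _) , t) = contradiction t ¬t
      after : (((W ∩ S⁺) ∩ ∁ Near) ∩ ∁ Touched) ⊆ (Far ∩ ∁ Touched ∩ After)
      after (((Wv , inj₁ (near , _)) , ¬near) , _) = contradiction near ¬near
      after (((Wv , inj₂ (_ , inj₁ (t , _))) , _) , ¬t) = contradiction t ¬t
      after (((Wv , inj₂ (_ , inj₂ (_ , a))) , ¬near) , ¬t) = (Wv , ¬near) , ¬t , a

    S⁻-colouring : Colouring E 13 (W ∩ ∁ S⁺ ∩ S⁻)
    S⁻-colouring =
      separate near? (restrict (λ ((Wv , _) , near) → Wv , near) near-colouring) (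
      separate touched? (restrict feeding feeding-colouring)
        (independent λ u v uv → let fu , ¬tu , _ = before u ; fv , _ , bv = before v in before-in fv bv fu ¬tu uv))
      where
      feeding : (((W ∩ ∁ S⁺ ∩ S⁻) ∩ ∁ Near) ∩ Touched) ⊆ (Far ∩ Feeding)
      feeding (((Wv , ¬s⁺ , _) , ¬near) , t) =
        (Wv , ¬near) , unfed t λ fed → ¬s⁺ (inj₂ (¬near , inj₁ (t , fed)))
      before : (((W ∩ ∁ S⁺ ∩ S⁻) ∩ ∁ Near) ∩ ∁ Touched) ⊆ (Far ∩ ∁ Touched ∩ Before)
      before (((Wv , _ , inj₁ near) , ¬near) , _) = contradiction near ¬near
      before (((Wv , _ , inj₂ (inj₁ t)) , _) , ¬t) = contradiction t ¬t
      before (((Wv , _ , inj₂ (inj₂ b)) , ¬near) , ¬t) = (Wv , ¬near) , ¬t , b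

    rest? : Decidable Rest
    rest? v = W? v ×-dec ¬? (s⁺? v) ×-dec ¬? (s⁻? v)

    peel : Colouring E 26 Rest → Colouring E 26 W
    peel = nice s⁺? s⁻? S⁺-closed S⁻-closed S⁺-colouring S⁻-colouring

    -- The vertex c 0 lies in W, but is near because of its predecessor on c, and so is not in
    -- `Rest`.
    fewer : length (filter rest? (allFin (n D))) < length (filter W? (allFin (n D)))
    fewer = count-mono-< rest? W? proj₁ (∈-allFin (c 0))
      (λ r → proj₂ (rest-far r) (within {λ b → b ~ c 0} (k * 2) (inj₁ (predecessor 0)))) (cW 0)

  -- The recursion and the final bound.

  step : ∃ OddClosed → ∃ λ (Rest : Pred V 0ℓ) → Σ (Decidable Rest) λ rest? →
    (Colouring E 26 Rest → Colouring E 26 W) ×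
    length (filter rest? (allFin (n D))) < length (filter W? (allFin (n D)))
  step (m , odd) = go (odd-half ℓ₀ (proj₁ least)) (proj₂ least)
    λ lt od π → <⇒≱ lt (first-minimal oddClosed? m (od , _ , π))
    where
    -- The given odd closed walk bounds the search for a shortest one.
    ℓ₀ = first oddClosed? m
    least = first-holds oddClosed? m odd ≤-refl
    go : ∀ {ℓ} → (∃ λ k → ℓ ≡ suc (k * 2)) → (∃ λ v → Walk ℓ v v) →
      (∀ {m v} → m < ℓ → parity m ≡ 1ℙ → ¬ Walk m v v) → _
    go (k , refl) (v , π) shortest = Rest , rest? , peel , fewer
      where open Peel k (unroll {R? = inner?} π) shortest

  two-colouring : (∀ v → ¬ Linked 1ℙ v v) → Colouring E 26 W
  two-colouring no-odd = widen (s≤s (s≤s z≤n)) (record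
    { colour = colour γ ; rank = rank γ ; descends = λ Wu Wv uv → descends γ tt tt (Wu , Wv , uv) })
    where γ = bipartite no-odd

colouring : (D : Digraph) → Oriented D → ¬ ContainsInducedP6 D → TriangleFree D →
  {W : Pred (Fin (n D)) 0ℓ} (W? : Decidable W) →
  Acc _<_ (length (filter W? (allFin (n D)))) → Colouring (Arc D) 26 W
colouring D oriented P6-free triangle-free W? (acc smaller) = go (any? λ v → linked? 1ℙ v v)
  where
  open Around D oriented P6-free triangle-free W?
  open Walks Inner inner?
  go : Dec (∃ λ v → Linked 1ℙ v v) → Colouring (Arc D) 26 _
  go (no none) = two-colouring λ v π → none (v , π)
  go (yes (v , k , odd , π)) = let _ , rest? , peel , fewer = step (suc k , odd , v , π) in
    peel (colouring D oriented P6-free triangle-free rest? (smaller fewer))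

theorem9p1p3 : (D : Digraph) → Oriented D → ¬ ContainsInducedP6 D → TriangleFree D →
    DichromaticAtMost 382 D
theorem9p1p3 D oriented P6-free triangle-free = colour γ , λ a → ranked-acyclic D oriented (rank γ)
  λ u≡a v≡a uv → descends γ tt tt uv (trans u≡a (sym v≡a))
  where
  γ : Colouring (Arc D) 382 U
  -- The 26 colours obtained lie well within 382 = 26 + 356.
  γ = widen (m≤m+n 26 356) (colouring D oriented P6-free triangle-free (λ _ → yes tt) (<-wellFounded _))
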